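{- Let $L$ be a logic extending $\mathsf{N4}^\bot+\{\neg\neg(p\wedge\sim p)\leftrightarrow(p\wedge\sim p)\}$. Then $\tau_{\mathbf{B}}L$ is a modal companion of $L$.
   Context: Languages: $\mathcal{L}_\sim=\{\wedge,\vee,\to,\bot,\sim\}$ and $\mathcal{L}^\Box_\sim=\mathcal{L}_\sim\cup\{\Box,\Diamond\}$, formulas over a countable set of variables; $\neg\varphi:=\varphi\to\bot$, $\varphi\leftrightarrow\psi:=(\varphi\to\psi)\wedge(\psi\to\varphi)$, $\varphi\Leftrightarrow\psi:=(\varphi\leftrightarrow\psi)\wedge(\sim\varphi\leftrightarrow\sim\psi)$. A logic in $\mathcal{L}_\sim$ is a set of formulas closed under substitution and modus ponens; a logic in $\mathcal{L}^\Box_\sim$ is additionally closed under $\varphi\to\psi/\Box\varphi\to\Box\psi$ and $\varphi\to\psi/\Diamond\varphi\to\Diamond\psi$. $\mathsf{N4}^\bot$ is the least logic in $\mathcal{L}_\sim$ containing the intuitionistic axioms ($p\to(q\to p)$; $(p\to(q\to r))\to((p\to q)\to(p\to r))$; $p\wedge q\to p$; $p\wedge q\to q$; $p\to(q\to p\wedge q)$; $p\to p\vee q$; $q\to p\vee q$; $(p\to r)\to((q\to r)\to(p\vee q\to r))$; $\bot\to p$) and $\sim(p\vee q)\leftrightarrow(\sim p\wedge\sim q)$, $\sim(p\wedge q)\leftrightarrow(\sim p\vee\sim q)$, $\sim(p\to q)\leftrightarrow(p\wedge\sim q)$, $\sim\sim p\leftrightarrow p$, $\sim\bot$. $\mathsf{BS4}$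 is the least logic in $\mathcal{L}^\Box_\sim$ containing these axioms, $p\vee\neg p$, $\Box(p\to p)$, $(\Box p\wedge\Box q)\to\Box(p\wedge q)$, $\Box p\to p$, $\Box p\to\Box\Box p$, $\neg\Box p\leftrightarrow\Diamond\neg p$, $\neg\Diamond p\leftrightarrow\Box\neg p$, $\Box p\Leftrightarrow\sim\Diamond\sim p$, $\Diamond p\Leftrightarrow\sim\Box\sim p$. Extensions are logics containing the given one; $L+X$ is the least logic containing $L\cup X$. Translation $\mathrm{T}_{\mathbf{B}}$: $\mathrm{T}_{\mathbf{B}}(p)=\Box p$, $\mathrm{T}_{\mathbf{B}}(\sim p)=\Box\sim p$, $\mathrm{T}_{\mathbf{B}}(\bot)=\bot$, $\mathrm{T}_{\mathbf{B}}(\sim\bot)=\sim\bot$, $\mathrm{T}_{\mathbf{B}}(\varphi\wedge\psi)=\mathrm{T}_{\mathbf{B}}\varphi\wedge\mathrm{T}_{\mathbf{B}}\psi$, $\mathrm{T}_{\mathbf{B}}(\varphi\vee\psi)=\mathrm{T}_{\mathbf{B}}\varphi\vee\mathrm{T}_{\mathbf{B}}\psi$, $\mathrm{T}_{\mathbf{B}}(\varphi\to\psi)=\Box(\mathrm{T}_{\mathbf{B}}\varphi\to\mathrm{T}_{\mathbf{B}}\psi)$, $\mathrm{T}_{\mathbf{B}}(\sim(\varphi\wedge\psi))=\mathrm{T}_{\mathbf{B}}(\sim\varphi)\vee\mathrm{T}_{\mathbf{B}}(\sim\psi)$, $\mathrm{T}_{\mathbf{B}}(\sim(\varphi\vee\psi))=\mathrm{T}_{\mathbf{B}}(\sim\varphi)\wedge\mathrm{T}_{\mathbf{B}}(\sim\psi)$,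 $\mathrm{T}_{\mathbf{B}}(\sim(\varphi\to\psi))=\mathrm{T}_{\mathbf{B}}\varphi\wedge\mathrm{T}_{\mathbf{B}}(\sim\psi)$, $\mathrm{T}_{\mathbf{B}}(\sim\sim\varphi)=\mathrm{T}_{\mathbf{B}}\varphi$. A modal companion of an extension $L$ of $\mathsf{N4}^\bot$ is an extension $M$ of $\mathsf{BS4}$ with $\varphi\in L\iff\mathrm{T}_{\mathbf{B}}\varphi\in M$ for every $\mathcal{L}_\sim$-formula $\varphi$; $\tau_{\mathbf{B}}L:=\mathsf{BS4}+\{\mathrm{T}_{\mathbf{B}}\varphi:\varphi\in L\}$. -}

module Defs where

open import Data.Nat using (ℕ)
open import Data.Product using (Σ; _×_)
open import Data.Sum using (_⊎_)
open import Relation.Binary.PropositionalEquality using (_≡_)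

infixr 6 _∧_
infixr 5 _∨_
infixr 4 _⇒_
infixr 4 _⇔_ _⟺_

data Fm : Set where
  var      : ℕ → Fm
  ⊥'       : Fm
  _∧_ _∨_ _⇒_ : Fm → Fm → Fm
  ∼_       : Fm → Fm

¬_ : Fm → Fm
¬ φ = φ ⇒ ⊥'

_⇔_ : Fm → Fm → Fm
φ ⇔ ψ = (φ ⇒ ψ) ∧ (ψ ⇒ φ)

sub : (ℕ → Fm) → Fm → Fm
sub σ (var n) = σ n
sub σ ⊥' = ⊥'
sub σ (φ ∧ ψ) = sub σ φ ∧ sub σ ψ
sub σ (φ ∨ ψ) = sub σ φ ∨ sub σ ψ
sub σ (φ ⇒ ψ) = sub σ φ ⇒ sub σ ψ
sub σ (∼ φ) = ∼ sub σ φ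

infixr 5 _∨ₘ_
infixr 6 _∧ₘ_
infixr 4 _⇒ₘ_

data MFm : Set where
  var      : ℕ → MFm
  ⊥'       : MFm
  _∧ₘ_ _∨ₘ_ _⇒ₘ_ : MFm → MFm → MFm
  ∼ₘ_      : MFm → MFm
  □ ◇      : MFm → MFm

¬ₘ_ : MFm → MFm
¬ₘ φ = φ ⇒ₘ ⊥'

_⇔ₘ_ : MFm → MFm → MFm
φ ⇔ₘ ψ = (φ ⇒ₘ ψ) ∧ₘ (ψ ⇒ₘ φ)

_⟺_ : MFm → MFm → MFm
φ ⟺ ψ = (φ ⇔ₘ ψ) ∧ₘ ((∼ₘ φ) ⇔ₘ (∼ₘ ψ))

msub : (ℕ → MFm) → MFm → MFm
msub σ (var n) = σ n
msub σ ⊥' = ⊥'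
msub σ (φ ∧ₘ ψ) = msub σ φ ∧ₘ msub σ ψ
msub σ (φ ∨ₘ ψ) = msub σ φ ∨ₘ msub σ ψ
msub σ (φ ⇒ₘ ψ) = msub σ φ ⇒ₘ msub σ ψ
msub σ (∼ₘ φ) = ∼ₘ msub σ φ
msub σ (□ φ) = □ (msub σ φ)
msub σ (◇ φ) = ◇ (msub σ φ)

emb : Fm → MFm
emb (var n) = var n
emb ⊥' = ⊥'
emb (φ ∧ ψ) = emb φ ∧ₘ emb ψ
emb (φ ∨ ψ) = emb φ ∨ₘ emb ψ
emb (φ ⇒ ψ) = emb φ ⇒ₘ emb ψ
emb (∼ φ) = ∼ₘ emb φ

record IsLogic (L : Fm → Set) : Set where
  field
    closed-sub : ∀ σ φ → L φ → L (sub σ φ)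
    closed-mp  : ∀ φ ψ → L φ → L (φ ⇒ ψ) → L ψ

record IsMLogic (M : MFm → Set) : Set where
  field
    closed-sub : ∀ σ φ → M φ → M (msub σ φ)
    closed-mp  : ∀ φ ψ → M φ → M (φ ⇒ₘ ψ) → M ψ
    closed-□   : ∀ φ ψ → M (φ ⇒ₘ ψ) → M (□ φ ⇒ₘ □ ψ)
    closed-◇   : ∀ φ ψ → M (φ ⇒ₘ ψ) → M (◇ φ ⇒ₘ ◇ ψ)

data Gen (X : Fm → Set) : Fm → Set where
  ax  : ∀ {φ} → X φ → Gen X φ
  sb  : ∀ σ {φ} → Gen X φ → Gen X (sub σ φ)
  mp  : ∀ {φ ψ} → Gen X φ → Gen X (φ ⇒ ψ) → Gen X ψ

data MGen (X : MFm → Set) : MFm → Set where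
  ax  : ∀ {φ} → X φ → MGen X φ
  sb  : ∀ σ {φ} → MGen X φ → MGen X (msub σ φ)
  mp  : ∀ {φ ψ} → MGen X φ → MGen X (φ ⇒ₘ ψ) → MGen X ψ
  mon□ : ∀ {φ ψ} → MGen X (φ ⇒ₘ ψ) → MGen X (□ φ ⇒ₘ □ ψ)
  mon◇ : ∀ {φ ψ} → MGen X (φ ⇒ₘ ψ) → MGen X (◇ φ ⇒ₘ ◇ ψ)

p q r : Fm
p = var 0
q = var 1
r = var 2

data N4Ax : Fm → Set where
  a1  : N4Ax (p ⇒ (q ⇒ p))
  a2  : N4Ax ((p ⇒ (q ⇒ r)) ⇒ ((p ⇒ q) ⇒ (p ⇒ r)))
  a3  : N4Ax (p ∧ q ⇒ p)
  a4  : N4Ax (p ∧ q ⇒ q)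
  a5  : N4Ax (p ⇒ (q ⇒ p ∧ q))
  a6  : N4Ax (p ⇒ p ∨ q)
  a7  : N4Ax (q ⇒ p ∨ q)
  a8  : N4Ax ((p ⇒ r) ⇒ ((q ⇒ r) ⇒ (p ∨ q ⇒ r)))
  a9  : N4Ax (⊥' ⇒ p)
  n1  : N4Ax ((∼ (p ∨ q)) ⇔ (∼ p ∧ ∼ q))
  n2  : N4Ax ((∼ (p ∧ q)) ⇔ (∼ p ∨ ∼ q))
  n3  : N4Ax ((∼ (p ⇒ q)) ⇔ (p ∧ ∼ q))
  n4  : N4Ax ((∼ (∼ p)) ⇔ p)
  n5  : N4Ax (∼ ⊥')

extraAx : Fm
extraAx = (¬ (¬ (p ∧ ∼ p))) ⇔ (p ∧ ∼ p)

N4Extra : Fm → Set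
N4Extra φ = N4Ax φ ⊎ φ ≡ extraAx

pₘ qₘ : MFm
pₘ = var 0
qₘ = var 1

data BS4Ax : MFm → Set where
  n4ax : ∀ {φ} → N4Ax φ → BS4Ax (emb φ)
  lem  : BS4Ax (pₘ ∨ₘ ¬ₘ pₘ)
  nec  : BS4Ax (□ (pₘ ⇒ₘ pₘ))
  kc   : BS4Ax ((□ pₘ ∧ₘ □ qₘ) ⇒ₘ □ (pₘ ∧ₘ qₘ))
  t    : BS4Ax (□ pₘ ⇒ₘ pₘ)
  four : BS4Ax (□ pₘ ⇒ₘ □ (□ pₘ))
  d1   : BS4Ax ((¬ₘ (□ pₘ)) ⇔ₘ ◇ (¬ₘ pₘ))
  d2   : BS4Ax ((¬ₘ (◇ pₘ)) ⇔ₘ □ (¬ₘ pₘ))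
  d3   : BS4Ax (□ pₘ ⟺ (∼ₘ (◇ (∼ₘ pₘ))))
  d4   : BS4Ax (◇ pₘ ⟺ (∼ₘ (□ (∼ₘ pₘ))))

BS4 : MFm → Set
BS4 = MGen BS4Ax

mutual
  T : Fm → MFm
  T (var n) = □ (var n)
  T ⊥' = ⊥'
  T (φ ∧ ψ) = T φ ∧ₘ T ψ
  T (φ ∨ ψ) = T φ ∨ₘ T ψ
  T (φ ⇒ ψ) = □ (T φ ⇒ₘ T ψ)
  T (∼ φ) = Tn φ

  Tn : Fm → MFm
  Tn (var n) = □ (∼ₘ var n)
  Tn ⊥' = ∼ₘ ⊥'
  Tn (φ ∧ ψ) = Tn φ ∨ₘ Tn ψ
  Tn (φ ∨ ψ) = Tn φ ∧ₘ Tn ψ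
  Tn (φ ⇒ ψ) = T φ ∧ₘ Tn ψ
  Tn (∼ φ) = T φ

τB : (Fm → Set) → MFm → Set
τB L = MGen (λ χ → BS4Ax χ ⊎ Σ Fm (λ φ → L φ × χ ≡ T φ))

record IsModalCompanion (L : Fm → Set) (M : MFm → Set) : Set where
  field
    logic    : IsMLogic M
    extends  : ∀ χ → BS4 χ → M χ
    faithful : ∀ φ → L φ → M (T φ)
    reflect  : ∀ φ → M (T φ) → L φ

{-# OPTIONS --safe #-}
module Submission where

-- The Lindenbaum algebra H of L is a Heyting algebra, and a pair (α , β) of its
-- elements is the pair (φ , ∼ φ) of some formula φ exactly when α ∨ β lies in a
-- filter ∇ containing the dense elements and α ∧ β lies in an ideal Δ, whose
-- members are regular by the extra axiom. Let B be the free Boolean extension of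
-- H, with interior operator □ whose open elements are those of H. The pairs
-- (X , Y) over B with □ (X ⊔ Y) in ∇ and □◇ (X ⊓ Y) in Δ form a model of BS4;
-- closure of the second condition under joins uses the McKinsey property of B
-- (□X ∨ □¬X is always dense) and regularity of Δ. For such a pair (□X , □Y) is
-- again the pair of a formula, so T φ takes at any valuation the value of a
-- substitution instance of φ. Hence the model validates τB L, and at the
-- canonical valuation T φ takes the value of φ itself.

open import Defs hiding (p; q; r)
open import Data.List using (List; []; _∷_; _++_; map)
open import Data.List.Relation.Unary.All as All using (All; []; _∷_)
open import Data.List.Relation.Unary.All.Properties using (++⁺; ++⁻ˡ; ++⁻ʳ; map⁺; map⁻)
open import Data.Nat using (ℕ; suc)
open import Data.Product using (_×_; _,_; proj₁; proj₂; swap)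
open import Data.Sum using (inj₁; inj₂)
open import Relation.Binary.PropositionalEquality using (_≡_; refl; sym; subst; cong; cong₂)

⊤' : Fm
⊤' = ⊥' ⇒ ⊥'

sub-var : ∀ φ → sub var φ ≡ φ
sub-var (var n) = refl
sub-var ⊥' = refl
sub-var (φ ∧ ψ) = cong₂ _∧_ (sub-var φ) (sub-var ψ)
sub-var (φ ∨ ψ) = cong₂ _∨_ (sub-var φ) (sub-var ψ)
sub-var (φ ⇒ ψ) = cong₂ _⇒_ (sub-var φ) (sub-var ψ)
sub-var (∼ φ) = cong ∼_ (sub-var φ)

inst : Fm → Fm → Fm → ℕ → Fm
inst φ ψ χ 0 = φ
inst φ ψ χ 1 = ψ
inst φ ψ χ (suc (suc _)) = χ

-- The Lindenbaum algebra of `L`.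

module Lindenbaum (L : Fm → Set) (isLogic : IsLogic L)
                  (extends : ∀ φ → Gen N4Extra φ → L φ) where

  open IsLogic isLogic

  infix 3 _≤_ _≈_

  _≤_ _≈_ : Fm → Fm → Set
  φ ≤ ψ = L (φ ⇒ ψ)
  φ ≈ ψ = φ ≤ ψ × ψ ≤ φ

  private variable
    α β γ δ φ ψ χ : Fm

  axiom : N4Ax α → ∀ φ ψ χ → L (sub (inst φ ψ χ) α)
  axiom a φ ψ χ = closed-sub _ _ (extends _ (ax (inj₁ a)))

  infixl 5 _·ᴸ_
  _·ᴸ_ : φ ≤ ψ → L φ → L ψ
  f ·ᴸ x = closed-mp _ _ x f

  const : L φ → ψ ≤ φ
  const x = axiom a1 _ _ ⊥' ·ᴸ x

  apply : γ ≤ (φ ⇒ ψ) → γ ≤ φ → γ ≤ ψ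
  apply f x = axiom a2 _ _ _ ·ᴸ f ·ᴸ x

  ≤-refl : φ ≤ φ
  ≤-refl {φ} = apply (axiom a1 φ (φ ⇒ φ) ⊥') (axiom a1 φ φ ⊥')

  ≤-trans : φ ≤ ψ → ψ ≤ χ → φ ≤ χ
  ≤-trans f g = apply (const g) f

  ⊤-intro : φ ≤ ⊤'
  ⊤-intro = const ≤-refl

  ⊥-elim : ⊥' ≤ φ
  ⊥-elim = axiom a9 _ ⊥' ⊥'

  π₁ : φ ∧ ψ ≤ φ
  π₁ = axiom a3 _ _ ⊥'

  π₂ : φ ∧ ψ ≤ ψ
  π₂ = axiom a4 _ _ ⊥'

  ∧-intro : γ ≤ φ → γ ≤ ψ → γ ≤ φ ∧ ψ
  ∧-intro f g = apply (≤-trans f (axiom a5 _ _ ⊥')) g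

  ∧-mono : α ≤ β → φ ≤ ψ → α ∧ φ ≤ β ∧ ψ
  ∧-mono f g = ∧-intro (≤-trans π₁ f) (≤-trans π₂ g)

  ι₁ : φ ≤ φ ∨ ψ
  ι₁ = axiom a6 _ _ ⊥'

  ι₂ : φ ≤ ψ ∨ φ
  ι₂ = axiom a7 _ _ ⊥'

  ∨-elim : φ ≤ χ → ψ ≤ χ → φ ∨ ψ ≤ χ
  ∨-elim f g = axiom a8 _ _ _ ·ᴸ f ·ᴸ g

  ∨-mono : α ≤ β → φ ≤ ψ → α ∨ φ ≤ β ∨ ψ
  ∨-mono f g = ∨-elim (≤-trans f ι₁) (≤-trans g ι₂)

  ∨-comm : φ ∨ ψ ≤ ψ ∨ φ
  ∨-comm = ∨-elim ι₂ ι₁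

  curry : φ ∧ ψ ≤ χ → φ ≤ ψ ⇒ χ
  curry f = ≤-trans (axiom a5 _ _ ⊥') (axiom a2 _ _ _ ·ᴸ const f)

  uncurry : φ ≤ ψ ⇒ χ → φ ∧ ψ ≤ χ
  uncurry f = apply (≤-trans π₁ f) π₂

  ∨-case : γ ≤ φ ∨ ψ → γ ∧ φ ≤ χ → γ ∧ ψ ≤ χ → γ ≤ χ
  ∨-case f g h = apply (≤-trans f (∨-elim (flip g) (flip h))) ≤-refl
    where
    flip : γ ∧ φ ≤ χ → φ ≤ γ ⇒ χ
    flip k = curry (≤-trans (∧-intro π₂ π₁) k)

  ¬-mono : φ ≤ ψ → ¬ ψ ≤ ¬ φ
  ¬-mono f = curry (apply π₁ (≤-trans π₂ f))

  ≈-refl : φ ≈ φ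
  ≈-refl = ≤-refl , ≤-refl

  ≈-trans : φ ≈ ψ → ψ ≈ χ → φ ≈ χ
  ≈-trans (f , g) (h , k) = ≤-trans f h , ≤-trans k g

  ≈-∧ : α ≈ β → φ ≈ ψ → α ∧ φ ≈ β ∧ ψ
  ≈-∧ (f , g) (h , k) = ∧-mono f h , ∧-mono g k

  ≈-∨ : α ≈ β → φ ≈ ψ → α ∨ φ ≈ β ∨ ψ
  ≈-∨ (f , g) (h , k) = ∨-mono f h , ∨-mono g k

  ⇔→≈ : L (φ ⇔ ψ) → φ ≈ ψ
  ⇔→≈ e = π₁ ·ᴸ e , π₂ ·ᴸ e

  ∼-∨ : ∼ (φ ∨ ψ) ≈ ∼ φ ∧ ∼ ψ
  ∼-∨ = ⇔→≈ (axiom n1 _ _ ⊥')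

  ∼-∧ : ∼ (φ ∧ ψ) ≈ ∼ φ ∨ ∼ ψ
  ∼-∧ = ⇔→≈ (axiom n2 _ _ ⊥')

  ∼-⇒ : ∼ (φ ⇒ ψ) ≈ φ ∧ ∼ ψ
  ∼-⇒ = ⇔→≈ (axiom n3 _ _ ⊥')

  ∼-∼ : ∼ ∼ φ ≈ φ
  ∼-∼ = ⇔→≈ (axiom n4 _ ⊥' ⊥')

  ∼-⊥ : φ ≤ ∼ ⊥'
  ∼-⊥ = const (axiom n5 ⊥' ⊥' ⊥')

  contradiction-regular : ¬ (¬ (φ ∧ ∼ φ)) ≤ φ ∧ ∼ φ
  contradiction-regular {φ} =
    π₁ ·ᴸ closed-sub (λ _ → φ) _ (extends _ (ax (inj₂ refl)))

  -- Dense elements.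

  Dense : Fm → Set
  Dense φ = ¬ φ ≤ ⊥'

  Dense-∨¬ : Dense (φ ∨ ¬ φ)
  Dense-∨¬ = apply ≤-refl (≤-trans (¬-mono ι₁) ι₂)

  Dense-mono : φ ≤ ψ → Dense φ → Dense ψ
  Dense-mono f d = ≤-trans (¬-mono f) d

  Dense-∧ : Dense φ → Dense ψ → Dense (φ ∧ ψ)
  Dense-∧ d e = ≤-trans
    (curry (≤-trans (curry (apply (≤-trans π₁ π₁) (∧-intro (≤-trans π₁ π₂) π₂))) e)) d

  -- Refuting a formula takes only the double negation of a disjunction, so a dense disjunction may
  -- be split into cases here.
  Dense-cases : Dense (φ ∨ ψ) → γ ∧ φ ≤ ⊥' → γ ∧ ψ ≤ ⊥' → γ ≤ ⊥'
  Dense-cases d f g = ≤-trans (curry (∨-case π₂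
    (≤-trans (∧-intro (≤-trans π₁ π₁) π₂) f)
    (≤-trans (∧-intro (≤-trans π₁ π₁) π₂) g))) d

  -- Pairs of the form (φ , ∼ φ)

  record Realized (α β : Fm) : Set where
    constructor realize
    field
      formula  : Fm
      positive : formula ≈ α
      negative : ∼ formula ≈ β

  open Realized

  self-realized : ∀ φ → Realized φ (∼ φ)
  self-realized φ = realize φ ≈-refl ≈-refl

  Realized-resp : α ≈ β → φ ≈ ψ → Realized α φ → Realized β ψ
  Realized-resp f g (realize c x y) = realize c (≈-trans x f) (≈-trans y g)

  Realized-∼ : Realized α β → Realized β α
  Realized-∼ (realize c x y) = realize (∼ c) y (≈-trans ∼-∼ x)

  Realized-∧ : Realized α β → Realized φ ψ → Realized (α ∧ φ) (β ∨ ψ)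
  Realized-∧ (realize c x y) (realize d z w) =
    realize (c ∧ d) (≈-∧ x z) (≈-trans ∼-∧ (≈-∨ y w))

  Realized-∨ : Realized α β → Realized φ ψ → Realized (α ∨ φ) (β ∧ ψ)
  Realized-∨ (realize c x y) (realize d z w) =
    realize (c ∨ d) (≈-∨ x z) (≈-trans ∼-∨ (≈-∧ y w))

  Realized-⇒ : ∀ χ → Realized α β → Realized (χ ⇒ α) (χ ∧ β)
  Realized-⇒ χ (realize c (f , g) y) = realize (χ ⇒ c)
    (curry (≤-trans (uncurry ≤-refl) f) , curry (≤-trans (uncurry ≤-refl) g))
    (≈-trans ∼-⇒ (≈-∧ ≈-refl y))

  -- Since `∼ α` need not be `¬ α`, the witness is `∼ (¬ α)`: it is equivalent to `α ∧ ∼ ⊥'`, and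
  -- `∼ ⊥'` is a theorem.
  Realized-¬ : ∀ α → Realized α (¬ α)
  Realized-¬ α = realize (∼ (¬ α))
    (≈-trans ∼-⇒ (π₁ , ∧-intro ≤-refl ∼-⊥)) ∼-∼

  -- Up to equivalence, these are the formulas `φ ∨ ∼ φ` and `φ ∧ ∼ φ`, each presented by a pair
  -- whose other component is trivial.
  ∇ Δ : Fm → Set
  ∇ α = Realized α ⊥'
  Δ α = Realized ⊤' α

  -- The join of `(α , ⊥')` with `(β , ¬ β)` is `(β , ⊥')`.
  ∇-up : α ≤ β → ∇ α → ∇ β
  ∇-up f r = Realized-resp (∨-elim f ≤-refl , ι₂) (π₁ , ⊥-elim)
    (Realized-∨ r (Realized-¬ _))

  ∇-∧ : ∇ α → ∇ β → ∇ (α ∧ β)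
  ∇-∧ r s = Realized-resp ≈-refl (∨-elim ≤-refl ≤-refl , ι₁) (Realized-∧ r s)

  Dense⇒∇ : Dense α → ∇ α
  Dense⇒∇ d = Realized-resp ≈-refl (d , ⊥-elim) (Realized-¬ _)

  -- Prefixing `α ⇒_` turns the pair `(β , ⊤')` into `(⊤' , α)`.
  Δ-down : α ≤ β → Δ β → Δ α
  Δ-down f r = Realized-resp (⊤-intro , const f) (π₁ , ∧-intro ≤-refl ⊤-intro)
    (Realized-⇒ _ (Realized-∼ r))

  Δ-∨ : Δ α → Δ β → Δ (α ∨ β)
  Δ-∨ r s = Realized-resp (π₁ , ∧-intro ≤-refl ≤-refl) ≈-refl (Realized-∧ r s)

  Δ-⊥ : Δ ⊥'
  Δ-⊥ = Realized-∼ (Realized-¬ ⊥')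

  Δ-regular : Δ α → ¬ (¬ α) ≤ α
  Δ-regular (realize c (_ , f) (g , h)) = ≤-trans
    (¬-mono (¬-mono (∧-intro (≤-trans ⊤-intro f) h)))
    (≤-trans contradiction-regular (≤-trans π₂ g))

  -- Joining `(α , β)`, its swap and `(α ∨ β , ¬ (α ∨ β))` makes the second component contradictory.
  Realized⇒∇ : Realized α β → ∇ (α ∨ β)
  Realized⇒∇ r = Realized-resp (∨-elim ≤-refl ≤-refl , ι₁)
    (apply π₂ (≤-trans π₁ (≤-trans π₂ ι₁)) , ⊥-elim)
    (Realized-∨ (Realized-∨ r (Realized-∼ r)) (Realized-¬ _))

  Realized⇒Δ : Realized α β → Δ (α ∧ β)
  Realized⇒Δ r = Realized-resp (⊤-intro , const ≤-refl)
    (π₁ , ∧-intro ≤-refl (≤-trans π₁ ι₂))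
    (Realized-⇒ _ (Realized-∧ r (Realized-∼ r)))

  -- With ν = α ∨ β and δ = α ∧ β, the pair (α , β) is (ν , δ) ⊓ (β ⇒ δ , β ∧ ν).
  ∇×Δ⇒Realized : ∇ (α ∨ β) → Δ (α ∧ β) → Realized α β
  ∇×Δ⇒Realized {α} {β} r s = Realized-resp
    ( ∨-case π₁ π₂ (≤-trans (apply (≤-trans π₁ π₂) π₂) π₁)
    , ∧-intro ι₁ (curry ≤-refl) )
    ( ∨-elim π₂ π₁ , ≤-trans (∧-intro ≤-refl ι₂) ι₂ )
    (Realized-∧ νδ (Realized-⇒ β (Realized-∼ νδ)))
    where
    νδ : Realized (α ∨ β) (α ∧ β)
    νδ = Realized-resp (π₁ , ∧-intro ≤-refl ⊤-intro) (∨-elim ⊥-elim ≤-refl , ι₂)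
      (Realized-∧ r s)

  -- The free Boolean extension

  -- A pair (c , d) is read both as the clause c → d and as the context
  -- "c holds and d fails"; a context is absurd when it refutes itself.
  Pair : Set
  Pair = Fm × Fm

  private variable
    e e′ e″ k l : Pair
    P N′ : List Pair

  infix 3 _⊒_ _⊨_
  infixl 6 _·_

  Absurd : Pair → Set
  Absurd (c , d) = c ≤ d

  _·_ : Pair → Pair → Pair
  (c , d) · (c′ , d′) = c ∧ c′ , d ∨ d′

  record _⊒_ (e′ e : Pair) : Set where
    constructor extension
    field
      left  : proj₁ e′ ≤ proj₁ e
      right : proj₂ e ≤ proj₂ e′

  ⊒-trans : e″ ⊒ e′ → e′ ⊒ e → e″ ⊒ e
  ⊒-trans (extension f g) (extension h k) = extension (≤-trans f h) (≤-trans k g)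

  ·-extends : e · k ⊒ e
  ·-extends = extension π₁ ι₁

  -- A clause holds in a context when the same pair, read as the context where that clause fails, is
  -- incompatible with it.
  _⊨_ : Pair → List Pair → Set
  e ⊨ P = All (λ k → Absurd (e · k)) P

  Absurd-mono : e′ ⊒ e → Absurd e → Absurd e′
  Absurd-mono (extension f g) a = ≤-trans f (≤-trans a g)

  ⊨-mono : e′ ⊒ e → e ⊨ P → e′ ⊨ P
  ⊨-mono (extension f g) =
    All.map (Absurd-mono (extension (∧-mono f ≤-refl) (∨-mono g ≤-refl)))

  ⊨-explode : Absurd e → e ⊨ P
  ⊨-explode a = All.universal (λ _ → Absurd-mono ·-extends a) _

  ·-assocˡ : Absurd (e · k · l) → Absurd (e · (k · l))
  ·-assocˡ = Absurd-mono (extension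
    (∧-intro (∧-intro π₁ (≤-trans π₂ π₁)) (≤-trans π₂ π₂))
    (∨-elim (∨-elim ι₁ (≤-trans ι₁ ι₂)) (≤-trans ι₂ ι₂)))

  ·-assocʳ : Absurd (e · (k · l)) → Absurd (e · k · l)
  ·-assocʳ = Absurd-mono (extension
    (∧-intro (≤-trans π₁ π₁) (∧-intro (≤-trans π₁ π₂) π₂))
    (∨-elim (≤-trans ι₁ ι₁) (∨-elim (≤-trans ι₂ ι₁) ι₂)))

  ·-absorb : e′ ⊒ e · k → Absurd (e′ · k) → Absurd e′
  ·-absorb (extension f g) a = ≤-trans (∧-intro ≤-refl (≤-trans f π₂))
    (≤-trans a (∨-elim ≤-refl (≤-trans ι₂ g)))

  -- Disjunction of conjunctive normal forms by distributivity: the clause `k · l` is the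
  -- disjunction of the clauses `k` and `l`.
  _⊗_ : List Pair → List Pair → List Pair
  [] ⊗ N′ = []
  (k ∷ N) ⊗ N′ = map (k ·_) N′ ++ (N ⊗ N′)

  ⊗-intro : ∀ N → All (λ k → e · k ⊨ N′) N → e ⊨ N ⊗ N′
  ⊗-intro [] [] = []
  ⊗-intro (k ∷ N) (x ∷ xs) = ++⁺ (map⁺ (All.map ·-assocˡ x)) (⊗-intro N xs)

  ⊗-elim : ∀ N → e ⊨ N ⊗ N′ → All (λ k → e · k ⊨ N′) N
  ⊗-elim [] _ = []
  ⊗-elim {N′ = N′} (k ∷ N) x =
    All.map ·-assocʳ (map⁻ (++⁻ˡ (map (k ·_) N′) x)) ∷ ⊗-elim N (++⁻ʳ (map (k ·_) N′) x)

  -- Reading each clause as a Heyting implication yields the largest element of the Heyting algebra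
  -- below the normal form, as the next two lemmas show.
  int : List Pair → Fm
  int [] = ⊤'
  int ((c , d) ∷ P) = (c ⇒ d) ∧ int P

  int-intro : ∀ P → (φ , ⊥') ⊨ P → φ ≤ int P
  int-intro [] [] = ⊤-intro
  int-intro (_ ∷ P) (x ∷ xs) =
    ∧-intro (curry (≤-trans x (∨-elim ⊥-elim ≤-refl))) (int-intro P xs)

  int-elim : ∀ P → φ ≤ int P → (φ , ⊥') ⊨ P
  int-elim [] f = []
  int-elim (_ ∷ P) f =
    ≤-trans (uncurry (≤-trans f π₁)) ι₂ ∷ int-elim P (≤-trans f π₂)

  -- Elements of the free Boolean extension of the Lindenbaum algebra, given by
  -- conjunctive normal forms of the element and of its complement. The last
  -- field is what makes the McKinsey formula valid.
  record Elt : Set where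
    no-eta-equality
    field
      pos neg  : List Pair
      disjoint : e ⊨ pos → e ⊨ neg → Absurd e
      pos-fail : (∀ {e′} → e′ ⊒ e → e′ ⊨ pos → Absurd e′) → e ⊨ neg
      neg-fail : (∀ {e′} → e′ ⊒ e → e′ ⊨ neg → Absurd e′) → e ⊨ pos
      dense    : Dense (int pos ∨ int neg)

  open Elt

  interior : Elt → Fm
  interior X = int (pos X)

  ∁ : Elt → Elt
  ∁ X .pos = neg X
  ∁ X .neg = pos X
  ∁ X .disjoint x y = disjoint X y x
  ∁ X .pos-fail = neg-fail X
  ∁ X .neg-fail = pos-fail X
  ∁ X .dense = Dense-mono ∨-comm (dense X)

  infixr 6 _⊓_
  infixr 5 _⊔_
  infixr 4 _⇛_

  _⊓_ _⊔_ _⇛_ : Elt → Elt → Elt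
  (X ⊓ Y) .pos = pos X ++ pos Y
  (X ⊓ Y) .neg = neg X ⊗ neg Y
  (X ⊓ Y) .disjoint x y = disjoint X (++⁻ˡ (pos X) x)
    (All.map (disjoint Y (⊨-mono ·-extends (++⁻ʳ (pos X) x))) (⊗-elim (neg X) y))
  -- Let a clause `k` of `neg X` fail. A context extending this one and forcing `Y` must force
  -- `neg X`, hence `k`, so it is absurd.
  (X ⊓ Y) .pos-fail f = ⊗-intro (neg X) (All.tabulate λ k∈N →
    pos-fail Y λ s y → ·-absorb s (All.lookup
      (pos-fail X λ s′ x → f (⊒-trans s′ (⊒-trans s ·-extends)) (++⁺ x (⊨-mono s′ y)))
      k∈N))
  (X ⊓ Y) .neg-fail f = ++⁺
    (neg-fail X λ s x → f s (⊗-intro (neg X) (All.map ⊨-explode x)))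
    (neg-fail Y λ s y → f s (⊗-intro (neg X) (All.universal (λ _ → ⊨-mono ·-extends y) _)))
  -- If both elements are necessary, so is their meet; if either is impossible, so is the meet.
  (X ⊓ Y) .dense = Dense-mono
    (∨-case π₁
      (∨-case (≤-trans π₁ π₂)
        (≤-trans (int-intro (pos X ++ pos Y)
          (++⁺ (int-elim (pos X) (≤-trans π₁ π₂)) (int-elim (pos Y) π₂))) ι₁)
        (≤-trans π₂ (≤-trans (int-intro (neg X ⊗ neg Y) (⊗-intro (neg X)
          (All.universal (λ _ → ⊨-mono ·-extends (int-elim (neg Y) ≤-refl)) _))) ι₂)))
      (≤-trans π₂ (≤-trans (int-intro (neg X ⊗ neg Y) (⊗-intro (neg X)
        (All.map ⊨-explode (int-elim (neg X) ≤-refl)))) ι₂)))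
    (Dense-∧ (dense X) (dense Y))
  X ⊔ Y = ∁ (∁ X ⊓ ∁ Y)
  X ⇛ Y = ∁ (X ⊓ ∁ Y)

  ι : Fm → Elt
  ι φ .pos = (⊤' , φ) ∷ []
  ι φ .neg = (φ , ⊥') ∷ []
  ι φ .disjoint (x ∷ []) (y ∷ []) = ∨-case
    (≤-trans (∧-intro ≤-refl ⊤-intro) x) π₂
    (≤-trans y (∨-elim ≤-refl ⊥-elim))
  ι φ .pos-fail f =
    f ·-extends (≤-trans π₁ (≤-trans π₂ ι₂) ∷ []) ∷ []
  ι φ .neg-fail f =
    f ·-extends (≤-trans π₂ (≤-trans ι₂ ι₁) ∷ []) ∷ []
  -- The interiors of `ι φ` and of its complement are `φ` and `¬ φ`, and excluded middle is dense in
  -- every Heyting algebra.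
  ι φ .dense = Dense-mono
    (∨-mono (∧-intro (curry π₁) ⊤-intro) (∧-intro ≤-refl ⊤-intro)) Dense-∨¬

  -- Forcing of Boolean elements in contexts.

  infix 3 _⊩_ _⊑_ _≅_

  -- Being a record, it lets `X` be inferred from `e ⊩ X`. Distinct elements with equal clauses are
  -- exchanged by rewrapping.
  record _⊩_ (e : Pair) (X : Elt) : Set where
    constructor forced
    field clauses : e ⊨ pos X

  _⊑_ _≅_ : Elt → Elt → Set
  X ⊑ Y = ∀ {e} → e ⊩ X → e ⊩ Y
  X ≅ Y = X ⊑ Y × Y ⊑ X

  private variable
    X Y Z W : Elt

  ⊩-mono : e′ ⊒ e → e ⊩ X → e′ ⊩ X
  ⊩-mono s (forced x) = forced (⊨-mono s x)

  ⊩-explode : Absurd e → e ⊩ X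
  ⊩-explode a = forced (⊨-explode a)

  ∁-intro : (∀ {e′} → e′ ⊒ e → e′ ⊩ X → Absurd e′) → e ⊩ ∁ X
  ∁-intro {X = X} f = forced (pos-fail X λ s x → f s (forced x))

  ∁-elim : e ⊩ ∁ X → e ⊩ X → Absurd e
  ∁-elim {X = X} (forced y) (forced x) = disjoint X x y

  by-contradiction : (∀ {e′} → e′ ⊒ e → e′ ⊩ ∁ X → Absurd e′) → e ⊩ X
  by-contradiction {X = X} f = forced (neg-fail X λ s x → f s (forced x))

  ⊓-intro : e ⊩ X → e ⊩ Y → e ⊩ X ⊓ Y
  ⊓-intro (forced x) (forced y) = forced (++⁺ x y)

  ⊓-fst : X ⊓ Y ⊑ X
  ⊓-fst {X} (forced x) = forced (++⁻ˡ (pos X) x)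

  ⊓-snd : X ⊓ Y ⊑ Y
  ⊓-snd {X} (forced x) = forced (++⁻ʳ (pos X) x)

  ⇛-intro : (∀ {e′} → e′ ⊒ e → e′ ⊩ X → e′ ⊩ Y) → e ⊩ X ⇛ Y
  ⇛-intro f =
    ∁-intro λ s z → ∁-elim (⊓-snd z) (f s (⊓-fst z))

  ⇛-elim : e ⊩ X ⇛ Y → e ⊩ X → e ⊩ Y
  ⇛-elim f x = by-contradiction λ s y →
    ∁-elim (⊩-mono s f) (⊓-intro (⊩-mono s x) y)

  ⊔-inl : X ⊑ X ⊔ Y
  ⊔-inl x = ∁-intro λ s z →
    ∁-elim (⊓-fst z) (⊩-mono s x)

  ⊔-inr : Y ⊑ X ⊔ Y
  ⊔-inr y = ∁-intro λ s z →
    ∁-elim (⊓-snd z) (⊩-mono s y)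

  ⊔-elim : e ⊩ X ⊔ Y → (∀ {e′} → e′ ⊒ e → e′ ⊩ X → e′ ⊩ Z) →
           (∀ {e′} → e′ ⊒ e → e′ ⊩ Y → e′ ⊩ Z) → e ⊩ Z
  ⊔-elim w f g = by-contradiction λ s z →
    ∁-elim (⊩-mono s w) (⊓-intro
      (∁-intro λ s′ x → ∁-elim (⊩-mono s′ z) (f (⊒-trans s′ s) x))
      (∁-intro λ s′ y → ∁-elim (⊩-mono s′ z) (g (⊒-trans s′ s) y)))

  ι-intro : proj₁ e ≤ proj₂ e ∨ φ → e ⊩ ι φ
  ι-intro f = forced (≤-trans π₁ f ∷ [])

  ι-elim : e ⊩ ι φ → proj₁ e ≤ proj₂ e ∨ φ
  ι-elim (forced (f ∷ [])) = ≤-trans (∧-intro ≤-refl ⊤-intro) f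

  ι-self : (φ , ⊥') ⊩ ι φ
  ι-self = ι-intro ι₂

  ι-reflect : (φ , ⊥') ⊩ ι ψ → φ ≤ ψ
  ι-reflect x = ≤-trans (ι-elim x) (∨-elim ⊥-elim ≤-refl)

  ⊥ᴱ-elim : e ⊩ ι ⊥' → Absurd e
  ⊥ᴱ-elim x = ≤-trans (ι-elim x) (∨-elim ≤-refl ⊥-elim)

  ι-mono : φ ≤ ψ → ι φ ⊑ ι ψ
  ι-mono f x = ι-intro (≤-trans (ι-elim x) (∨-mono ≤-refl f))

  restrict : φ ≤ ψ → (ψ , ⊥') ⊩ X → (φ , ⊥') ⊩ X
  restrict f = ⊩-mono (extension f ≤-refl)

  interior-forces : (interior X , ⊥') ⊩ X
  interior-forces {X} = forced (int-elim (pos X) ≤-refl)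

  interior-greatest : (φ , ⊥') ⊩ X → φ ≤ interior X
  interior-greatest {X = X} (forced x) = int-intro (pos X) x

  interior-mono : X ⊑ Y → interior X ≤ interior Y
  interior-mono f = interior-greatest (f interior-forces)

  -- A context `(c , d)` forcing `ι φ` satisfies `c ≤ d ∨ φ`: in the first case it is absurd, in the
  -- second the hypothesis applies.
  ι-forces : (φ , ⊥') ⊩ X → ι φ ⊑ X
  ι-forces {φ} (forced xs) {e} y = forced (All.map step xs)
    where
    step : Absurd ((φ , ⊥') · k) → Absurd (e · k)
    step a = ∨-case (≤-trans π₁ (ι-elim y)) (≤-trans π₂ ι₁)
      (≤-trans (∧-intro π₂ (≤-trans π₁ π₂)) (≤-trans a (∨-mono ⊥-elim ≤-refl)))

  -- The interior operator on the extension.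

  □ᴱ ◇ᴱ : Elt → Elt
  □ᴱ X = ι (interior X)
  ◇ᴱ X = ∁ (□ᴱ (∁ X))

  □-T : □ᴱ X ⊑ X
  □-T = ι-forces interior-forces

  □-4 : □ᴱ X ⊑ □ᴱ (□ᴱ X)
  □-4 = ι-mono (interior-greatest ι-self)

  □-mono : X ⊑ Y → □ᴱ X ⊑ □ᴱ Y
  □-mono f = ι-mono (interior-mono f)

  ι-∧ : e ⊩ ι φ → e ⊩ ι ψ → e ⊩ ι (φ ∧ ψ)
  ι-∧ x y = ι-intro (∨-case (ι-elim x) (≤-trans π₂ ι₁)
    (∨-case (≤-trans π₁ (ι-elim y)) (≤-trans π₂ ι₁)
      (≤-trans (∧-mono π₂ ≤-refl) ι₂)))

  ι-∨ : ι (φ ∨ ψ) ⊑ ι φ ⊔ ι ψ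
  ι-∨ x = ∁-intro λ s z →
    ∨-case (ι-elim (⊩-mono s x)) π₂
      (∨-case π₂
        (refute (⊓-fst z)) (refute (⊓-snd z)))
    where
    refute : e ⊩ ∁ (ι α) → (proj₁ e ∧ β) ∧ α ≤ proj₂ e
    refute (forced (f ∷ [])) = ≤-trans (∧-mono π₁ ≤-refl) (≤-trans f (∨-elim ≤-refl ⊥-elim))

  □-rule : (∀ {e} → e ⊩ X → e ⊩ Y → e ⊩ Z) → e ⊩ □ᴱ X → e ⊩ □ᴱ Y → e ⊩ □ᴱ Z
  □-rule f x y = ι-mono (interior-greatest
    (f (restrict π₁ interior-forces) (restrict π₂ interior-forces))) (ι-∧ x y)

  ◇-mono : X ⊑ Y → ◇ᴱ X ⊑ ◇ᴱ Y
  ◇-mono f x = ∁-intro λ s y → ∁-elim (⊩-mono s x)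
    (□-mono (λ w → ∁-intro λ s′ z → ∁-elim (⊩-mono s′ w) (f z)) y)

  ◇-intro : X ⊑ ◇ᴱ X
  ◇-intro x = ∁-intro λ s y → ∁-elim (□-T y) (⊩-mono s x)

  ◇-idem : ◇ᴱ (◇ᴱ X) ⊑ ◇ᴱ X
  ◇-idem {X} x = ∁-intro λ s y →
    ∁-elim (⊩-mono s x)
      (□-mono {□ᴱ (∁ X)} {∁ (◇ᴱ X)} (λ { (forced w) → forced w }) (□-4 {∁ X} y))

  -- Where `◇ᴱ Y` fails, the complement of `Y` is necessary, and normality gives `□ᴱ X`. This keeps
  -- values exhaustive under `□ⱽ`.
  □-⊔ : □ᴱ (X ⊔ Y) ⊑ □ᴱ X ⊔ ◇ᴱ Y
  □-⊔ {X} {Y} x = ∁-intro λ s z →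
    ∁-elim (⊓-fst z)
      (□-rule {X ⊔ Y} {∁ Y} {X}
        (λ u w → ⊔-elim u (λ _ a → a) (λ s′ b → ⊩-explode (∁-elim (⊩-mono s′ w) b)))
        (⊩-mono s x) (unpack (⊓-snd z)))
    where
    unpack : ∁ (◇ᴱ Y) ⊑ □ᴱ (∁ Y)
    unpack (forced w) = forced w

  -- The dual fact, which keeps values consistent under `□ⱽ`.
  □-⊓-◇ : □ᴱ X ⊓ ◇ᴱ Y ⊑ ◇ᴱ (X ⊓ Y)
  □-⊓-◇ {X} {Y} x = ∁-intro λ s z →
    ∁-elim (⊩-mono s (⊓-snd x))
      (□-rule {X} {∁ (X ⊓ Y)} {∁ Y}
        (λ u w → ∁-intro λ s′ y → ∁-elim (⊩-mono s′ w) (⊓-intro (⊩-mono s′ u) y))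
        (⊩-mono s (⊓-fst x)) z)

  -- The filter and the ideal on the extension.

  record Designated (X : Elt) : Set where
    constructor designated
    field interior-∇ : ∇ (interior X)

  record Tolerated (X : Elt) : Set where
    constructor tolerated
    field □◇-Δ : Δ (interior (◇ᴱ X))

  Designated-up : X ⊑ Y → Designated X → Designated Y
  Designated-up f (designated r) = designated (∇-up (interior-mono f) r)

  Designated-⊓ : Designated X → Designated Y → Designated (X ⊓ Y)
  Designated-⊓ {X} {Y} (designated r) (designated s) = designated (∇-up
    (interior-greatest {X = X ⊓ Y}
      (⊓-intro (restrict π₁ interior-forces) (restrict π₂ interior-forces)))
    (∇-∧ r s))

  Designated-□ : Designated X → Designated (□ᴱ X)
  Designated-□ (designated r) = designated (∇-up (interior-greatest ι-self) r)

  Tolerated-down : X ⊑ Y → Tolerated Y → Tolerated X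
  Tolerated-down {X} {Y} f (tolerated r) =
    tolerated (Δ-down (interior-mono {◇ᴱ X} {◇ᴱ Y} (◇-mono {X} {Y} f)) r)

  Tolerated-◇ : Tolerated X → Tolerated (◇ᴱ X)
  Tolerated-◇ {X} (tolerated r) =
    tolerated (Δ-down (interior-mono {◇ᴱ (◇ᴱ X)} {◇ᴱ X} (◇-idem {X})) r)

  □◇-refuted : interior (◇ᴱ X) ∧ interior (∁ X) ≤ ⊥'
  □◇-refuted {X} = ∁-elim {X = □ᴱ (∁ X)}
    (restrict π₁ (interior-forces {◇ᴱ X})) (restrict π₂ ι-self)

  -- By the McKinsey property one may assume that each of X and Y is, in the
  -- current context, necessarily true or necessarily false.
  □◇-⊔ : interior (◇ᴱ (X ⊔ Y)) ≤ ¬ (¬ (interior (◇ᴱ X) ∨ interior (◇ᴱ Y)))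
  □◇-⊔ {X} {Y} = curry (Dense-cases (dense X)
    (refute X ι₁ (≤-trans π₁ π₂) π₂)
    (Dense-cases (dense Y)
      (refute Y ι₂ (≤-trans π₁ (≤-trans π₁ π₂)) π₂)
      (≤-trans
        (∧-intro (≤-trans π₁ (≤-trans π₁ π₁))
          (interior-greatest {X = ∁ (X ⊔ Y)}
            (∁-intro {X = X ⊔ Y} λ s w →
              ∁-elim w (⊓-intro
                (⊩-mono s (restrict (≤-trans π₁ π₂) (interior-forces {∁ X})))
                (⊩-mono s (restrict π₂ (interior-forces {∁ Y})))))))
        (□◇-refuted {X ⊔ Y}))))
    where
    refute : ∀ Z → interior (◇ᴱ Z) ≤ φ → γ ≤ ¬ φ → γ ≤ interior Z → γ ≤ ⊥'
    refute Z f g h = apply g (≤-trans h (≤-trans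
      (interior-mono {Z} {◇ᴱ Z} (◇-intro {Z})) f))

  -- `□◇-⊔` gives only a doubly negated bound; the bound lies in `Δ`, so regularity removes the
  -- double negation.
  Tolerated-⊔ : Tolerated X → Tolerated Y → Tolerated (X ⊔ Y)
  Tolerated-⊔ {X} {Y} (tolerated r) (tolerated s) = tolerated (Δ-down
    (≤-trans (□◇-⊔ {X} {Y}) (Δ-regular (Δ-∨ r s))) (Δ-∨ r s))

  -- The twist structure over the free Boolean extension

  record Val : Set where
    no-eta-equality
    field
      yes no     : Elt
      exhaustive : Designated (yes ⊔ no)
      consistent : Tolerated (yes ⊓ no)

  open Val

  ∼ⱽ : Val → Val
  ∼ⱽ a .yes = no a
  ∼ⱽ a .no = yes a
  ∼ⱽ a .exhaustive = Designated-up (λ x → ⊔-elim x (λ _ → ⊔-inr) (λ _ → ⊔-inl)) (exhaustive a)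
  ∼ⱽ a .consistent = Tolerated-down (λ x → ⊓-intro (⊓-snd x) (⊓-fst x)) (consistent a)

  ⊥ⱽ : Val
  ⊥ⱽ .yes = ι ⊥'
  ⊥ⱽ .no = ∁ (ι ⊥')
  ⊥ⱽ .exhaustive = designated (∇-up (interior-greatest {φ = ⊤'} {X = ι ⊥' ⊔ ∁ (ι ⊥')}
      (⊔-inr (∁-intro λ _ x → ⊥ᴱ-elim x)))
    (Dense⇒∇ (apply ≤-refl ⊤-intro)))
  ⊥ⱽ .consistent = tolerated (Δ-down
    (≤-trans (∧-intro ≤-refl (interior-greatest {X = ∁ (ι ⊥' ⊓ ∁ (ι ⊥'))}
        (∁-intro λ _ x → ∁-elim (⊓-snd x) (⊓-fst x))))
      (□◇-refuted {ι ⊥' ⊓ ∁ (ι ⊥')}))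
    Δ-⊥)

  _∧ⱽ_ _∨ⱽ_ _⇒ⱽ_ : Val → Val → Val
  (a ∧ⱽ b) .yes = yes a ⊓ yes b
  (a ∧ⱽ b) .no = no a ⊔ no b
  (a ∧ⱽ b) .exhaustive = Designated-up
    (λ x → ⊔-elim (⊓-fst x)
      (λ s y → ⊔-elim (⊩-mono s (⊓-snd x))
        (λ s′ z → ⊔-inl (⊓-intro (⊩-mono s′ y) z)) (λ _ z → ⊔-inr (⊔-inr z)))
      (λ _ y → ⊔-inr (⊔-inl y)))
    (Designated-⊓ (exhaustive a) (exhaustive b))
  (a ∧ⱽ b) .consistent = Tolerated-down
    (λ x → ⊔-elim (⊓-snd x)
      (λ s y → ⊔-inl (⊓-intro (⊩-mono s (⊓-fst (⊓-fst x))) y))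
      (λ s y → ⊔-inr (⊓-intro (⊩-mono s (⊓-snd (⊓-fst x))) y)))
    (Tolerated-⊔ (consistent a) (consistent b))
  a ∨ⱽ b = ∼ⱽ (∼ⱽ a ∧ⱽ ∼ⱽ b)
  (a ⇒ⱽ b) .yes = yes a ⇛ yes b
  (a ⇒ⱽ b) .no = yes a ⊓ no b
  (a ⇒ⱽ b) .exhaustive = Designated-up
    (λ x → ⊔-elim x
      (λ _ y → ⊔-inl (⇛-intro λ s _ → ⊩-mono s y))
      -- Where `no b` holds and the goal fails, `yes a` is contradictory, so the implication holds
      -- vacuously.
      (λ _ y → by-contradiction λ s z → ∁-elim z (⊔-inl (⇛-intro λ s′ w →
        ⊩-explode (∁-elim (⊩-mono s′ z) (⊔-inr (⊓-intro w (⊩-mono (⊒-trans s′ s) y))))))))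
    (exhaustive b)
  (a ⇒ⱽ b) .consistent = Tolerated-down
    (λ x → ⊓-intro (⇛-elim (⊓-fst x) (⊓-fst (⊓-snd x))) (⊓-snd (⊓-snd x)))
    (consistent b)

  □ⱽ ◇ⱽ : Val → Val
  □ⱽ a .yes = □ᴱ (yes a)
  □ⱽ a .no = ◇ᴱ (no a)
  □ⱽ a .exhaustive =
    Designated-up (□-⊔ {yes a} {no a}) (Designated-□ {yes a ⊔ no a} (exhaustive a))
  □ⱽ a .consistent =
    Tolerated-down (□-⊓-◇ {yes a} {no a}) (Tolerated-◇ {yes a ⊓ no a} (consistent a))
  ◇ⱽ a = ∼ⱽ (□ⱽ (∼ⱽ a))

  -- Evaluation and soundness of the axioms of `BS4`.

  eval : MFm → (ℕ → Val) → Val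
  eval (var n) v = v n
  eval ⊥' v = ⊥ⱽ
  eval (φ ∧ₘ ψ) v = eval φ v ∧ⱽ eval ψ v
  eval (φ ∨ₘ ψ) v = eval φ v ∨ⱽ eval ψ v
  eval (φ ⇒ₘ ψ) v = eval φ v ⇒ⱽ eval ψ v
  eval (∼ₘ φ) v = ∼ⱽ (eval φ v)
  eval (□ φ) v = □ⱽ (eval φ v)
  eval (◇ φ) v = ◇ⱽ (eval φ v)

  eval-msub : ∀ σ v χ → eval (msub σ χ) v ≡ eval χ (λ n → eval (σ n) v)
  eval-msub σ v (var n) = refl
  eval-msub σ v ⊥' = refl
  eval-msub σ v (φ ∧ₘ ψ) = cong₂ _∧ⱽ_ (eval-msub σ v φ) (eval-msub σ v ψ)
  eval-msub σ v (φ ∨ₘ ψ) = cong₂ _∨ⱽ_ (eval-msub σ v φ) (eval-msub σ v ψ)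
  eval-msub σ v (φ ⇒ₘ ψ) = cong₂ _⇒ⱽ_ (eval-msub σ v φ) (eval-msub σ v ψ)
  eval-msub σ v (∼ₘ φ) = cong ∼ⱽ (eval-msub σ v φ)
  eval-msub σ v (□ φ) = cong □ⱽ (eval-msub σ v φ)
  eval-msub σ v (◇ φ) = cong ◇ⱽ (eval-msub σ v φ)

  True : Elt → Set
  True X = ∀ {e} → e ⊩ X

  ⊑⇒True : X ⊑ Y → True (X ⇛ Y)
  ⊑⇒True f = ⇛-intro λ _ → f

  ≅⇒True : X ⊑ Y → Y ⊑ X → True ((X ⇛ Y) ⊓ (Y ⇛ X))
  ≅⇒True f g = ⊓-intro (⊑⇒True f) (⊑⇒True g)

  ∁⇒¬ : ∁ X ⊑ X ⇛ ι ⊥'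
  ∁⇒¬ x = ⇛-intro λ s y → ⊩-explode (∁-elim (⊩-mono s x) y)

  ¬⇒∁ : X ⇛ ι ⊥' ⊑ ∁ X
  ¬⇒∁ x = ∁-intro λ s y → ⊥ᴱ-elim (⇛-elim (⊩-mono s x) y)

  ∁∁-intro : X ⊑ ∁ (∁ X)
  ∁∁-intro (forced x) = forced x

  ∁∁-elim : ∁ (∁ X) ⊑ X
  ∁∁-elim (forced x) = forced x

  ∁-anti : X ⊑ Y → ∁ Y ⊑ ∁ X
  ∁-anti f y = ∁-intro λ s x → ∁-elim (⊩-mono s y) (f x)

  N4Ax-sound : N4Ax φ → ∀ v → True (yes (eval (emb φ) v))
  N4Ax-sound a1 v = ⇛-intro λ _ x → ⇛-intro λ s _ → ⊩-mono s x
  N4Ax-sound a2 v = ⇛-intro λ _ f → ⇛-intro λ s g → ⇛-intro λ s′ x →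
    ⇛-elim (⇛-elim (⊩-mono (⊒-trans s′ s) f) x) (⇛-elim (⊩-mono s′ g) x)
  N4Ax-sound a3 v = ⊑⇒True ⊓-fst
  N4Ax-sound a4 v = ⊑⇒True ⊓-snd
  N4Ax-sound a5 v = ⇛-intro λ _ x → ⇛-intro λ s y → ⊓-intro (⊩-mono s x) y
  N4Ax-sound a6 v = ⊑⇒True ⊔-inl
  N4Ax-sound a7 v = ⊑⇒True ⊔-inr
  N4Ax-sound a8 v = ⇛-intro λ _ f → ⇛-intro λ s g → ⇛-intro λ s′ x → ⊔-elim x
    (λ s″ → ⇛-elim (⊩-mono (⊒-trans s″ (⊒-trans s′ s)) f))
    (λ s″ → ⇛-elim (⊩-mono (⊒-trans s″ s′) g))
  N4Ax-sound a9 v = ⊑⇒True λ x → ⊩-explode (⊥ᴱ-elim x)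
  -- For `n1` to `n4`, the twist operations give both sides the same first component.
  N4Ax-sound n1 v = ≅⇒True (λ x → x) (λ x → x)
  N4Ax-sound n2 v = ≅⇒True (λ x → x) (λ x → x)
  N4Ax-sound n3 v = ≅⇒True (λ x → x) (λ x → x)
  N4Ax-sound n4 v = ≅⇒True (λ x → x) (λ x → x)
  N4Ax-sound n5 v = ∁-intro λ _ x → ⊥ᴱ-elim x

  BS4Ax-sound : ∀ {χ} → BS4Ax χ → ∀ v → True (yes (eval χ v))
  BS4Ax-sound (n4ax a) v = N4Ax-sound a v
  BS4Ax-sound lem v = by-contradiction λ _ x →
    ∁-elim x (⊔-inr (⇛-intro λ s y → ⊩-explode (∁-elim (⊩-mono s x) (⊔-inl y))))
  BS4Ax-sound nec v = ι-mono
    (interior-greatest {X = yes (v 0) ⇛ yes (v 0)} (⊑⇒True λ x → x))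
    (ι-intro {φ = ⊤'} (≤-trans ⊤-intro ι₂))
  BS4Ax-sound kc v = ⊑⇒True λ x →
    □-rule {yes (v 0)} {yes (v 1)} {yes (v 0) ⊓ yes (v 1)} ⊓-intro (⊓-fst x) (⊓-snd x)
  BS4Ax-sound t v = ⊑⇒True (□-T {yes (v 0)})
  BS4Ax-sound four v = ⊑⇒True (□-4 {yes (v 0)})
  BS4Ax-sound d1 v = ≅⇒True
    (λ x → ∁-anti (□-mono {∁ (A ⇛ ι ⊥')} {A} (λ y → ∁∁-elim (∁-anti ∁⇒¬ y))) (¬⇒∁ x))
    (λ x → ∁⇒¬ (∁-anti (□-mono {A} {∁ (A ⇛ ι ⊥')} (λ y → ∁-anti ¬⇒∁ (∁∁-intro y))) x))
    where
    A : Elt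
    A = yes (v 0)
  BS4Ax-sound d2 v = ≅⇒True
    (λ x → □-mono {∁ A} {A ⇛ ι ⊥'} ∁⇒¬ (∁∁-elim (¬⇒∁ x)))
    (λ x → ∁⇒¬ (∁∁-intro (□-mono {A ⇛ ι ⊥'} {∁ A} ¬⇒∁ x)))
    where
    A : Elt
    A = yes (v 0)
  -- Both components agree because `◇ⱽ` is defined from `□ⱽ` by this duality.
  BS4Ax-sound d3 v = ⊓-intro (≅⇒True (λ x → x) (λ x → x)) (≅⇒True (λ x → x) (λ x → x))
  BS4Ax-sound d4 v = ⊓-intro (≅⇒True (λ x → x) (λ x → x)) (≅⇒True (λ x → x) (λ x → x))

  -- Values of translated formulas.

  ⊓-cong : X ≅ Z → Y ≅ W → X ⊓ Y ≅ Z ⊓ W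
  ⊓-cong (f , g) (h , k) =
    (λ x → ⊓-intro (f (⊓-fst x)) (h (⊓-snd x))) , (λ x → ⊓-intro (g (⊓-fst x)) (k (⊓-snd x)))

  ⊔-cong : X ≅ Z → Y ≅ W → X ⊔ Y ≅ Z ⊔ W
  ⊔-cong (f , g) (h , k) =
    (λ x → ⊔-elim x (λ _ y → ⊔-inl (f y)) (λ _ y → ⊔-inr (h y))) ,
    (λ x → ⊔-elim x (λ _ y → ⊔-inl (g y)) (λ _ y → ⊔-inr (k y)))

  ≅-trans : X ≅ Y → Y ≅ Z → X ≅ Z
  ≅-trans (f , g) (h , k) = (λ x → h (f x)) , (λ x → g (k x))

  ι-cong : φ ≈ ψ → ι φ ≅ ι ψ
  ι-cong (f , g) = ι-mono f , ι-mono g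

  ι-⊓ : ι φ ⊓ ι ψ ≅ ι (φ ∧ ψ)
  ι-⊓ = (λ x → ι-∧ (⊓-fst x) (⊓-snd x)) , (λ x → ⊓-intro (ι-mono π₁ x) (ι-mono π₂ x))

  ι-⊔ : ι φ ⊔ ι ψ ≅ ι (φ ∨ ψ)
  ι-⊔ = (λ x → ⊔-elim x (λ _ → ι-mono ι₁) (λ _ → ι-mono ι₂)) , ι-∨

  -- An element `χ` of the Heyting algebra lies below the Boolean implication exactly when
  -- `χ ∧ φ ≤ ψ`, which characterizes `φ ⇒ ψ`.
  □-⇛ : X ≅ ι φ → Y ≅ ι ψ → □ᴱ (X ⇛ Y) ≅ ι (φ ⇒ ψ)
  □-⇛ {X} {φ} {Y} {ψ} (f , g) (h , k) =
    ι-mono (curry (ι-reflect (h (⇛-elim (restrict π₁ (interior-forces {X ⇛ Y}))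
      (g (restrict π₂ ι-self)))))) ,
    ι-mono (interior-greatest {X = X ⇛ Y} (⇛-intro λ s x →
      k (ι-mono (uncurry ≤-refl) (ι-∧ (⊩-mono s ι-self) (f x)))))

  module Translation (v : ℕ → Val) (σ : ℕ → Fm)
    (pos-σ : ∀ n → interior (yes (v n)) ≈ σ n)
    (neg-σ : ∀ n → interior (no (v n)) ≈ ∼ σ n) where

    mutual
      -- Variables enter a translation only under `□`, so a valuation matters only through the
      -- interiors of its two components.
      T-eval : ∀ φ → yes (eval (T φ) v) ≅ ι (sub σ φ)
      T-eval (var n) = ι-cong (pos-σ n)
      T-eval ⊥' = (λ x → x) , (λ x → x)
      T-eval (φ ∧ ψ) = ≅-trans (⊓-cong (T-eval φ) (T-eval ψ)) ι-⊓
      T-eval (φ ∨ ψ) = ≅-trans (⊔-cong (T-eval φ) (T-eval ψ)) ι-⊔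
      T-eval (φ ⇒ ψ) = □-⇛ (T-eval φ) (T-eval ψ)
      T-eval (∼ φ) = Tn-eval φ

      Tn-eval : ∀ φ → yes (eval (Tn φ) v) ≅ ι (∼ sub σ φ)
      Tn-eval (var n) = ι-cong (neg-σ n)
      Tn-eval ⊥' = (λ _ → ι-intro (≤-trans ∼-⊥ ι₂)) , (λ _ → ∁-intro λ _ x → ⊥ᴱ-elim x)
      Tn-eval (φ ∧ ψ) = ≅-trans (⊔-cong (Tn-eval φ) (Tn-eval ψ)) (≅-trans ι-⊔ (ι-cong (swap ∼-∧)))
      Tn-eval (φ ∨ ψ) = ≅-trans (⊓-cong (Tn-eval φ) (Tn-eval ψ)) (≅-trans ι-⊓ (ι-cong (swap ∼-∨)))
      Tn-eval (φ ⇒ ψ) = ≅-trans (⊓-cong (T-eval φ) (Tn-eval ψ)) (≅-trans ι-⊓ (ι-cong (swap ∼-⇒)))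
      Tn-eval (∼ φ) = ≅-trans (T-eval φ) (ι-cong (swap ∼-∼))

  -- □ does not distribute over ⊔; the McKinsey property of X makes up for it.
  interiors-∇ : Designated (X ⊔ Y) → ∇ (interior X ∨ interior Y)
  interiors-∇ {X} {Y} (designated d) = ∇-up
    (∨-case π₂ (≤-trans π₂ ι₁)
      (≤-trans (interior-greatest {X = Y}
        (⊔-elim (restrict (≤-trans π₁ π₁) (interior-forces {X ⊔ Y}))
          (λ s x → ⊩-explode (∁-elim (⊩-mono s (restrict π₂ (interior-forces {∁ X}))) x))
          (λ _ y → y))) ι₂))
    (∇-∧ d (Dense⇒∇ (dense X)))

  -- An open element below `X ⊓ Y` is also below the interior of `◇ᴱ (X ⊓ Y)`.
  interiors-Δ : Tolerated (X ⊓ Y) → Δ (interior X ∧ interior Y)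
  interiors-Δ {X} {Y} (tolerated d) = Δ-down (interior-greatest {X = ◇ᴱ (X ⊓ Y)} (◇-intro {X ⊓ Y}
    (⊓-intro (restrict π₁ (interior-forces {X})) (restrict π₂ (interior-forces {Y}))))) d

  value-realized : ∀ a → Realized (interior (yes a)) (interior (no a))
  value-realized a = ∇×Δ⇒Realized (interiors-∇ (exhaustive a)) (interiors-Δ (consistent a))

  -- The formulas realizing the interiors at the variables form a substitution `σ`, and `L` contains
  -- `sub σ φ`.
  T-sound : L φ → ∀ v → True (yes (eval (T φ) v))
  T-sound {φ} x v = proj₂ (T-eval φ)
    (ι-intro (≤-trans (const (closed-sub σ φ x)) ι₂))
    where
    realized : ∀ n → Realized (interior (yes (v n))) (interior (no (v n)))
    realized n = value-realized (v n)
    σ : ℕ → Fm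
    σ n = formula (realized n)
    open Translation v σ (λ n → swap (positive (realized n))) (λ n → swap (negative (realized n)))

  τB-sound : ∀ {χ} → τB L χ → ∀ v → True (yes (eval χ v))
  τB-sound (ax (inj₁ a)) v = BS4Ax-sound a v
  τB-sound (ax (inj₂ (φ , x , refl))) v = T-sound x v
  τB-sound (sb σ {χ} x) v =
    subst (λ a → True (yes a)) (sym (eval-msub σ v χ)) (τB-sound x _)
  τB-sound (mp x y) v = ⇛-elim (τB-sound y v) (τB-sound x v)
  τB-sound (mon□ {φ} {ψ} x) v =
    ⊑⇒True (□-mono {yes (eval φ v)} {yes (eval ψ v)} (⇛-elim (τB-sound x v)))
  τB-sound (mon◇ {φ} {ψ} x) v =
    ⊑⇒True (◇-mono {yes (eval φ v)} {yes (eval ψ v)} (⇛-elim (τB-sound x v)))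

  generic : Fm → Val
  generic φ .yes = ι φ
  generic φ .no = ι (∼ φ)
  generic φ .exhaustive = designated (∇-up
    (interior-greatest {X = ι φ ⊔ ι (∼ φ)} (ι-∨ ι-self)) (Realized⇒∇ (self-realized φ)))
  -- The interior of `◇ᴱ` here lies below the double negation of `φ ∧ ∼ φ`, which the extra axiom
  -- collapses.
  generic φ .consistent = tolerated (Δ-down
    (≤-trans (curry (≤-trans (∧-mono ≤-refl refuted) (□◇-refuted {ι φ ⊓ ι (∼ φ)})))
      contradiction-regular)
    (Realized⇒Δ (self-realized φ)))
    where
    refuted : ¬ (φ ∧ ∼ φ) ≤ interior (∁ (ι φ ⊓ ι (∼ φ)))
    refuted = interior-greatest {X = ∁ (ι φ ⊓ ι (∼ φ))} (∁-intro λ s x →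
      ⊥ᴱ-elim (ι-mono (uncurry ≤-refl) (ι-∧ (⊩-mono s ι-self) (proj₁ ι-⊓ x))))

  interior-ι : interior (ι φ) ≈ φ
  interior-ι = apply π₁ ⊤-intro , interior-greatest ι-self

  T-reflect : ∀ φ → τB L (T φ) → L φ
  T-reflect φ x = subst L (sub-var φ)
    -- The context is `(⊤' , ⊥')`, which assumes nothing, so forcing there amounts to membership in
    -- `L`.
    (ι-reflect (proj₁ (T-eval φ) (τB-sound x _)) ·ᴸ ≤-refl {⊥'})
    where open Translation (λ n → generic (var n)) var (λ _ → interior-ι) (λ _ → interior-ι)

-- `τB L` as a modal companion.

BS4⊆τB : ∀ {L χ} → BS4 χ → τB L χ
BS4⊆τB (ax a) = ax (inj₁ a)
BS4⊆τB (sb σ x) = sb σ (BS4⊆τB x)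
BS4⊆τB (mp x y) = mp (BS4⊆τB x) (BS4⊆τB y)
BS4⊆τB (mon□ x) = mon□ (BS4⊆τB x)
BS4⊆τB (mon◇ x) = mon◇ (BS4⊆τB x)

theorem4p1p3 : (L : Fm → Set) → IsLogic L → (∀ φ → Gen N4Extra φ → L φ) →
    IsModalCompanion L (τB L)
theorem4p1p3 L isLogic extends = record
  { logic = record
    { closed-sub = λ σ _ → sb σ
    ; closed-mp  = λ _ _ → mp
    ; closed-□   = λ _ _ → mon□
    ; closed-◇   = λ _ _ → mon◇
    }
  ; extends  = λ _ → BS4⊆τB
  ; faithful = λ φ x → ax (inj₂ (φ , x , refl))
  ; reflect  = Lindenbaum.T-reflect L isLogic extends
  }
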